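{- For each infinite set $T \subseteq \mathbb{N}^+$ and each natural number $k \ge 1$, $\mathrm{UP}_{\le k} \subseteq \mathrm{RC}_T$.
   Context: For an NPTM (nondeterministic polynomial-time Turing machine) $N$ and string $x$, $\#\mathrm{acc}_N(x)$ is the number of accepting computation paths of $N$ on input $x$. For $S \subseteq \mathbb{N}^+$, $\mathrm{RC}_S$ is the class of languages $L$ for which there is an NPTM $N$ such that for every string $x$: if $x \notin L$ then $\#\mathrm{acc}_N(x)=0$, and if $x \in L$ then $\#\mathrm{acc}_N(x) \in S$. For $k \in \mathbb{N}^+$, $\mathrm{UP}_{\le k}$ is the class of languages $L$ for which there is an NPTM $N$ such that for every $x$: if $x \notin L$ then $\#\mathrm{acc}_N(x)=0$, and if $x \in L$ then $1 \le \#\mathrm{acc}_N(x) \le k$. -}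

module Defs where

open import Data.Nat using (ℕ; zero; suc; _+_; _*_; _^_; _≤_)
open import Data.Fin using (Fin; zero; suc)
open import Data.Bool using (Bool; true; false)
open import Data.List using (List; []; _∷_; length; map)
open import Data.Nat.ListAction using (sum)
open import Data.List.Relation.Unary.All using (All)
open import Data.Product using (Σ; _×_; _,_; ∃)
open import Data.Sum using (_⊎_)
open import Relation.Binary.PropositionalEquality using (_≡_)
open import Relation.Nullary using (¬_)

-- Nondeterministic single-tape Turing machines over input alphabet {0,1}
--
-- States  : Fin (3 + q);  state 0 = start, 1 = accept, 2 = reject.
-- Symbols : Fin (3 + g);  symbol 0 = blank, 1 = bit false, 2 = bit true.
-- The transition relation lists, for each (state, scanned symbol), the
-- possible moves; each list entry is a distinct nondeterministic choice.

data Move : Set where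
  left right stay : Move

record NTM : Set where
  field
    q : ℕ
    g : ℕ
    δ : Fin (3 + q) → Fin (3 + g) → List (Fin (3 + q) × Fin (3 + g) × Move)

module _ (M : NTM) where
  open NTM M

  State = Fin (3 + q)
  Sym   = Fin (3 + g)

  blank : Sym
  blank = zero

  encBit : Bool → Sym
  encBit false = suc zero
  encBit true  = suc (suc zero)

  -- configuration: state, tape left of head (nearest first), scanned
  -- symbol, tape right of head (nearest first); the tape is blank beyond.
  record Config : Set where
    constructor conf
    field
      st    : State
      lft   : List Sym
      hd    : Sym
      rgt   : List Sym

  initial : List Bool → Config
  initial []       = conf zero [] blank []
  initial (b ∷ bs) = conf zero [] (encBit b) (map encBit bs)

  data Halted : Config → Set where
    h-acc : ∀ {l h r} → Halted (conf (suc zero) l h r)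
    h-rej : ∀ {l h r} → Halted (conf (suc (suc zero)) l h r)

  -- apply one transition (left end of the tape: head stays put)
  apply : Config → State × Sym × Move → Config
  apply (conf _ l _ r) (s , w , stay)      = conf s l w r
  apply (conf _ [] _ r) (s , w , left)     = conf s [] w r
  apply (conf _ (a ∷ l) _ r) (s , w , left) = conf s l a (w ∷ r)
  apply (conf _ l _ []) (s , w , right)    = conf s (w ∷ l) blank []
  apply (conf _ l _ (a ∷ r)) (s , w , right) = conf s (w ∷ l) a r

  step : Config → List Config
  step c@(conf zero l h r)                 = map (apply c) (δ zero h)
  step (conf (suc zero) l h r)             = []
  step (conf (suc (suc zero)) l h r)       = []
  step c@(conf (suc (suc (suc s))) l h r)  = map (apply c) (δ (suc (suc (suc s))) h)

  -- every computation path from c ends (halts or gets stuck) within t steps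
  Finishes : ℕ → Config → Set
  Finishes zero    c = Halted c
  Finishes (suc t) c = Halted c ⊎ All (Finishes t) (step c)

  accPaths : ℕ → Config → ℕ
  accPaths t (conf (suc zero) l h r) = 1
  accPaths zero c = 0
  accPaths (suc t) c = sum (map (accPaths t) (step c))

record NPTM : Set where
  field
    machine : NTM
    c d     : ℕ
    polyTime : (x : List Bool) →
               Finishes machine (c * length x ^ d + c) (initial machine x)

#acc : NPTM → List Bool → ℕ
#acc N x = accPaths machine (c * length x ^ d + c) (initial machine x)
  where open NPTM N

Language : Set₁
Language = List Bool → Set

RC : (ℕ → Set) → Language → Set
RC S L = Σ NPTM λ N → (x : List Bool) →
           (¬ L x → #acc N x ≡ 0) × (L x → S (#acc N x))

UP≤ : ℕ → Language → Set
UP≤ k L = Σ NPTM λ N → (x : List Bool) →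
            (¬ L x → #acc N x ≡ 0) × (L x → 1 ≤ #acc N x × #acc N x ≤ k)

PosSubset : (ℕ → Set) → Set
PosSubset T = (n : ℕ) → T n → 1 ≤ n

Infinite : (ℕ → Set) → Set
Infinite T = (n : ℕ) → ∃ λ m → n ≤ m × T m

{-# OPTIONS --safe #-}
module Submission where

-- Let a ≤ k be the number of accepting paths of N.  Since C(a, i) vanishes for
-- a < i and is 1 for a = i, weights wᵢ can be chosen one after the other so that
-- Σ wᵢ C(a, i) lies in T for every a = 1, …, k.  A machine that guesses i with
-- multiplicity wᵢ and then accepts once for every i-element set of accepting paths
-- of N has this number of accepting paths.
--
-- The paths of such a set are followed one after the other in lexicographic order,
-- on several tracks of one tape.  As long as several paths agree, their tracks are
-- written together; where they separate, the tracks of the later paths stop being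
-- written, and a mark left in the scanned cell tells where and how to resume them.
-- Saving a configuration thus costs no time, and resuming it is a single search for
-- its mark.  Vandermonde's identity matches the ways of distributing the paths of a
-- set among the successors of a configuration.

open import Defs
open import Data.Nat using (ℕ; zero; suc; pred; _+_; _*_; _∸_; _^_; _≤_; _<_; _⊓_; _⊔_; z≤n; s≤s; _≤?_; _≟_)
import Algebra.Properties.CommutativeSemigroup
open import Data.Bool using (Bool; true; false; if_then_else_; _∧_)
open import Data.Empty using (⊥-elim)
open import Data.Fin as Fin using (Fin; zero; suc; toℕ; fromℕ<; combine; remQuot; funToFin; finToFun)
open import Data.Fin.Properties using (toℕ-fromℕ<; *↔×; +↔⊎; 2↔Bool; remQuot-combine; finToFun-funToFin)
open import Data.List using (List; []; _∷_; _++_; _ʳ++_; map; length; drop; replicate)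
open import Data.List.Properties using (map-++; map-∘; map-cong)
open import Data.List.Relation.Unary.All as All using (All; []; _∷_)
import Data.List.Relation.Unary.All.Properties as All
open import Data.Maybe using (Maybe; just; nothing)
open import Data.Nat.Combinatorics using (nCn≡1; k>n⇒nCk≡0; nCk+nC[k+1]≡[n+1]C[k+1]) renaming (_C_ to infixl 8 _choose_)
open import Data.Nat.ListAction using (sum)
open import Data.Nat.ListAction.Properties using (sum-++)
open import Data.Nat.Properties hiding (_≟_; _≤?_)
open import Data.Nat.Solver using (module +-*-Solver)
open import Data.Product using (∃; _×_; _,_; proj₁; proj₂)
open import Data.Product.Function.NonDependent.Propositional using (_×-↪_)
open import Data.Sum using (_⊎_; inj₁; inj₂)
open import Data.Sum.Function.Propositional using (_⊎-↪_)
open import Function using (_∘_; _↪_; mk↪; module RightInverse)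
open import Function.Construct.Composition using (_↪-∘_)
open import Function.Construct.Identity using (↔-id)
open import Function.Construct.Symmetry using (↔-sym)
open import Function.Properties.Inverse using (↔⇒↪)
open import Relation.Binary.Definitions using (tri<; tri≈; tri>)
open import Relation.Binary.PropositionalEquality
open import Relation.Nullary using (yes; no; does)
open import Relation.Nullary.Decidable using (dec-true; dec-false)

open Algebra.Properties.CommutativeSemigroup +-commutativeSemigroup using (interchange)

-- Convolutions of sequences and Vandermonde's identity.

splits : ℕ → List (ℕ × ℕ)
splits zero    = (0 , 0) ∷ []
splits (suc n) = (0 , suc n) ∷ map (λ (a , b) → suc a , b) (splits n)

splits-sum : ∀ n → All (λ (a , b) → a + b ≡ n) (splits n)
splits-sum zero    = refl ∷ []
splits-sum (suc n) = refl ∷ All.map⁺ (All.map (cong suc) (splits-sum n))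

-- The Cauchy product, that is, coefficient `n` of the product of two generating functions.
convolve : (ℕ → ℕ) → (ℕ → ℕ) → ℕ → ℕ
convolve f g n = sum (map (λ (a , b) → f a * g b) (splits n))

convolve-suc : ∀ f g n → convolve f g (suc n) ≡ f 0 * g (suc n) + convolve (f ∘ suc) g n
convolve-suc f g n = cong (λ xs → f 0 * g (suc n) + sum xs) (sym (map-∘ (splits n)))

convolve-cong : ∀ {f f′} g n → (∀ a → f a ≡ f′ a) → convolve f g n ≡ convolve f′ g n
convolve-cong g n eq = cong sum (map-cong (λ (a , b) → cong (_* g b) (eq a)) (splits n))

convolve-zeroˡ : ∀ {f} g n → (∀ a → f a ≡ 0) → convolve f g n ≡ 0
convolve-zeroˡ g n eq = trans (convolve-cong g n eq) (sum-zeros (splits n))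
  where
  sum-zeros : (xs : List (ℕ × ℕ)) → sum (map (λ (a , b) → 0 * g b) xs) ≡ 0
  sum-zeros []       = refl
  sum-zeros (_ ∷ xs) = sum-zeros xs

convolve-+ˡ : ∀ f f′ g n → convolve (λ a → f a + f′ a) g n ≡ convolve f g n + convolve f′ g n
convolve-+ˡ f f′ g n = go (splits n)
  where
  open ≡-Reasoning
  Σ[_] : (ℕ → ℕ) → List (ℕ × ℕ) → ℕ
  Σ[ h ] xs = sum (map (λ (a , b) → h a * g b) xs)
  go : ∀ xs → Σ[ (λ a → f a + f′ a) ] xs ≡ Σ[ f ] xs + Σ[ f′ ] xs
  go [] = refl
  go ((a , b) ∷ xs) = begin
    (f a + f′ a) * g b + Σ[ (λ a → f a + f′ a) ] xs
      ≡⟨ cong₂ _+_ (*-distribʳ-+ (g b) (f a) (f′ a)) (go xs) ⟩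
    (f a * g b + f′ a * g b) + (Σ[ f ] xs + Σ[ f′ ] xs)
      ≡⟨ interchange (f a * g b) (f′ a * g b) (Σ[ f ] xs) (Σ[ f′ ] xs) ⟩
    (f a * g b + Σ[ f ] xs) + (f′ a * g b + Σ[ f′ ] xs) ∎

convolve-*ʳ : ∀ f g c n → convolve f (λ b → g b * c) n ≡ convolve f g n * c
convolve-*ʳ f g c n = go (splits n)
  where
  go : (xs : List (ℕ × ℕ)) →
       sum (map (λ (a , b) → f a * (g b * c)) xs) ≡ sum (map (λ (a , b) → f a * g b) xs) * c
  go []             = refl
  go ((a , b) ∷ xs) =
    trans (cong₂ _+_ (sym (*-assoc (f a) (g b) c)) (go xs)) (sym (*-distribʳ-+ c (f a * g b) _))

nC0≡1 : ∀ n → n choose 0 ≡ 1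
nC0≡1 zero    = refl
nC0≡1 (suc n) = refl

-- Induction on `x`. Once the term at 0 is split off, Pascal's rule divides the rest into two sums,
-- which regroup as the identity for `x` at `n` and at `suc n`.
vandermonde : ∀ x y n → convolve (x choose_) (y choose_) n ≡ (x + y) choose n
vandermonde x y zero rewrite nC0≡1 x | nC0≡1 y | nC0≡1 (x + y) = refl
vandermonde zero y (suc n) = begin
  convolve (0 choose_) (y choose_) (suc n)
    ≡⟨ convolve-suc (0 choose_) (y choose_) n ⟩
  (0 choose 0) * (y choose suc n) + convolve (λ a → 0 choose suc a) (y choose_) n
    ≡⟨ cong₂ _+_ (*-identityˡ (y choose suc n))
                 (convolve-zeroˡ {λ a → 0 choose suc a} (y choose_) n λ a → k>n⇒nCk≡0 {0} {suc a} (s≤s z≤n)) ⟩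
  y choose suc n + 0
    ≡⟨ +-identityʳ _ ⟩
  y choose suc n ∎
  where open ≡-Reasoning
vandermonde (suc x) y (suc n) = begin
  convolve (suc x choose_) (y choose_) (suc n)
    ≡⟨ convolve-suc (suc x choose_) (y choose_) n ⟩
  (suc x choose 0) * (y choose suc n) + convolve (λ a → suc x choose suc a) (y choose_) n
    ≡⟨ cong₂ _+_ (cong (_* (y choose suc n)) (trans (nC0≡1 (suc x)) (sym (nC0≡1 x))))
                 (convolve-cong (y choose_) n λ a → sym (nCk+nC[k+1]≡[n+1]C[k+1] x a)) ⟩
  P + convolve (λ a → x choose a + x choose suc a) (y choose_) n
    ≡⟨ cong (P +_) (convolve-+ˡ (x choose_) (λ a → x choose suc a) (y choose_) n) ⟩
  P + (Q + R)
    ≡⟨ +-assoc P Q R ⟨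
  P + Q + R
    ≡⟨ cong (_+ R) (+-comm P Q) ⟩
  Q + P + R
    ≡⟨ +-assoc Q P R ⟩
  Q + (P + R)
    ≡⟨ cong (Q +_) (convolve-suc (x choose_) (y choose_) n) ⟨
  Q + convolve (x choose_) (y choose_) (suc n)
    ≡⟨ cong₂ _+_ (vandermonde x y n) (vandermonde x y (suc n)) ⟩
  (x + y) choose n + (x + y) choose suc n
    ≡⟨ nCk+nC[k+1]≡[n+1]C[k+1] (x + y) n ⟩
  suc (x + y) choose suc n ∎
  where
  open ≡-Reasoning
  P = (x choose 0) * (y choose suc n)
  Q = convolve (x choose_) (y choose_) n
  R = convolve (λ a → x choose suc a) (y choose_) n

-- This form matches the options of the machine: with `x` paths behind the current move and `y`
-- behind the later ones, a set has `suc a` paths of the first kind or avoids that move altogether.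
vandermonde⁺ : ∀ x y n →
  convolve (λ a → x choose suc a) (y choose_) n + y choose suc n ≡ (x + y) choose suc n
vandermonde⁺ x y n = begin
  R + y choose suc n
    ≡⟨ +-comm R (y choose suc n) ⟩
  y choose suc n + R
    ≡⟨ cong (_+ R) (*-identityˡ (y choose suc n)) ⟨
  1 * (y choose suc n) + R
    ≡⟨ cong (λ z → z * (y choose suc n) + R) (nC0≡1 x) ⟨
  (x choose 0) * (y choose suc n) + R
    ≡⟨ convolve-suc (x choose_) (y choose_) n ⟨
  convolve (x choose_) (y choose_) (suc n)
    ≡⟨ vandermonde x y (suc n) ⟩
  (x + y) choose suc n ∎
  where
  open ≡-Reasoning
  R = convolve (λ a → x choose suc a) (y choose_) n

-- Weights that carry 1, ..., k into an infinite set.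

-- The entry i of a plan stands for the subset size i + 1; its weight is its multiplicity.
weight : List ℕ → ℕ → ℕ
weight plan a = sum (map (λ i → a choose suc i) plan)

weight-0 : ∀ plan → weight plan 0 ≡ 0
weight-0 []         = refl
weight-0 (i ∷ plan) = cong₂ _+_ (k>n⇒nCk≡0 {0} {suc i} (s≤s z≤n)) (weight-0 plan)

weight-replicate : ∀ n i plan a → weight (replicate n i ++ plan) a ≡ n * a choose suc i + weight plan a
weight-replicate zero    i plan a = refl
weight-replicate (suc n) i plan a =
  trans (cong (a choose suc i +_) (weight-replicate n i plan a)) (sym (+-assoc (a choose suc i) (n * a choose suc i) _))

-- C(a, k+1) vanishes for a ≤ k, so the weight of size k+1 adjusts the value at
-- k+1 upwards without disturbing smaller arguments.
plan-into : ∀ {T : ℕ → Set} → Infinite T → ∀ k →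
  ∃ λ plan → All (_< k) plan × (∀ a → 1 ≤ a → a ≤ k → T (weight plan a))
plan-into inf zero = [] , [] , λ { zero () _ ; (suc _) _ () }
plan-into {T} inf (suc k)
  with plan , sizes , vals ← plan-into inf k
  with m , w≤m , Tm ← inf (weight plan (suc k))
  = replicate n k ++ plan , All.++⁺ (All.replicate⁺ n (n<1+n k)) (All.map m<n⇒m<1+n sizes) , values
  where
  -- At `suc k` each copy of entry `k` adds exactly 1, so the number of copies is the whole gap up
  -- to `m`.
  n = m ∸ weight plan (suc k)
  values : ∀ a → 1 ≤ a → a ≤ suc k → T (weight (replicate n k ++ plan) a)
  values a 1≤a a≤k+1 with m≤n⇒m<n∨m≡n a≤k+1
  ... | inj₁ a<k+1 = subst T (sym eq) (vals a 1≤a (≤-pred a<k+1))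
    where
    eq : weight (replicate n k ++ plan) a ≡ weight plan a
    eq = trans (weight-replicate n k plan a)
               (cong (_+ weight plan a) (trans (cong (n *_) (k>n⇒nCk≡0 a<k+1)) (*-zeroʳ n)))
  ... | inj₂ refl = subst T (sym eq) Tm
    where
    eq : weight (replicate n k ++ plan) (suc k) ≡ m
    eq = trans (weight-replicate n k plan (suc k))
         (trans (cong (_+ weight plan (suc k)) (trans (cong (n *_) (nCn≡1 (suc k))) (*-identityʳ n)))
                (m∸n+n≡m w≤m))

-- Turing machines in absolute tape coordinates.

module Semantics (M : NTM) where
  open Config public

  -- The default `zero` is the blank: lists that differ in trailing blanks describe the same tape,
  -- so tapes are compared cell by cell and never as lists.
  look : List (Sym M) → ℕ → Sym M
  look []       i       = zero
  look (x ∷ xs) zero    = x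
  look (x ∷ xs) (suc i) = look xs i

  -- Cells are numbered from the left end. These numbers do not shift with the head, so tapes of
  -- different configurations and of different machines can be compared.
  at : Config M → ℕ → Sym M
  at (conf s l h r) = look (l ʳ++ h ∷ r)

  pos : Config M → ℕ
  pos c = length (lft c)

  look-ʳ++-≥ : ∀ l xs i → look (l ʳ++ xs) (length l + i) ≡ look xs i
  look-ʳ++-≥ []      xs i = refl
  look-ʳ++-≥ (a ∷ l) xs i =
    trans (cong (look (l ʳ++ a ∷ xs)) (sym (+-suc (length l) i))) (look-ʳ++-≥ l (a ∷ xs) (suc i))

  look-ʳ++-here : ∀ l x xs → look (l ʳ++ x ∷ xs) (length l) ≡ x
  look-ʳ++-here l x xs =
    trans (cong (look (l ʳ++ x ∷ xs)) (sym (+-identityʳ (length l)))) (look-ʳ++-≥ l (x ∷ xs) 0)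

  look-ʳ++-cong : ∀ l {xs ys} → (∀ i → look xs i ≡ look ys i) →
                  ∀ i → look (l ʳ++ xs) i ≡ look (l ʳ++ ys) i
  look-ʳ++-cong []      eq i = eq i
  look-ʳ++-cong (a ∷ l) eq i = look-ʳ++-cong l (λ { zero → refl ; (suc j) → eq j }) i

  look-ʳ++-there : ∀ l {x y} xs i → i ≢ length l →
                   look (l ʳ++ x ∷ xs) i ≡ look (l ʳ++ y ∷ xs) i
  look-ʳ++-there l {x} {y} xs i i≢ with <-cmp i (length l)
  ... | tri≈ _ i≡ _ = ⊥-elim (i≢ i≡)
  ... | tri> _ _ l<i = subst (λ i → look (l ʳ++ x ∷ xs) i ≡ look (l ʳ++ y ∷ xs) i)
                         (trans (+-suc (length l) _) (m+[n∸m]≡n l<i))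
                         (trans (look-ʳ++-≥ l (x ∷ xs) (suc _)) (sym (look-ʳ++-≥ l (y ∷ xs) (suc _))))
  ... | tri< i<l _ _ = below l i i<l
    where
    below : ∀ l {xs ys} i → i < length l → look (l ʳ++ xs) i ≡ look (l ʳ++ ys) i
    below (a ∷ l) {xs} {ys} i i<1+l with m≤n⇒m<n∨m≡n (≤-pred i<1+l)
    ... | inj₁ i<l  = below l i i<l
    ... | inj₂ refl = trans (look-ʳ++-here l a xs) (sym (look-ʳ++-here l a ys))

  hd≡at : ∀ c → hd c ≡ at c (pos c)
  hd≡at (conf s l h r) = sym (look-ʳ++-here l h r)

  -- `pred 0` being 0 agrees with the head staying put at the left end.
  moved : Move → ℕ → ℕ
  moved left  p = pred p
  moved right p = suc p
  moved stay  p = p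

  st-apply : ∀ c {s w} mv → st (apply M c (s , w , mv)) ≡ s
  st-apply (conf _ l _ r)       stay  = refl
  st-apply (conf _ [] _ r)      left  = refl
  st-apply (conf _ (_ ∷ _) _ r) left  = refl
  st-apply (conf _ l _ [])      right = refl
  st-apply (conf _ l _ (_ ∷ _)) right = refl

  pos-apply : ∀ c {s w} mv → pos (apply M c (s , w , mv)) ≡ moved mv (pos c)
  pos-apply (conf _ l _ r)       stay  = refl
  pos-apply (conf _ [] _ r)      left  = refl
  pos-apply (conf _ (_ ∷ _) _ r) left  = refl
  pos-apply (conf _ l _ [])      right = refl
  pos-apply (conf _ l _ (_ ∷ _)) right = refl

  at-apply : ∀ c {s w} mv i → at (apply M c (s , w , mv)) i ≡ look (lft c ʳ++ w ∷ rgt c) i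
  at-apply (conf _ l _ r)       stay  i = refl
  at-apply (conf _ [] _ r)      left  i = refl
  at-apply (conf _ (_ ∷ _) _ r) left  i = refl
  -- Stepping past the list appends an explicit blank, which `look` does not tell from the end of
  -- the list.
  at-apply (conf _ l _ [])      right i =
    look-ʳ++-cong l (λ { zero → refl ; (suc zero) → refl ; (suc (suc _)) → refl }) i
  at-apply (conf _ l _ (_ ∷ _)) right i = refl

  at-apply-here : ∀ c {s w} mv → at (apply M c (s , w , mv)) (pos c) ≡ w
  at-apply-here c {w = w} mv = trans (at-apply c mv (pos c)) (look-ʳ++-here (lft c) w (rgt c))

  at-apply-there : ∀ c {s w} mv {i} → i ≢ pos c → at (apply M c (s , w , mv)) i ≡ at c i
  at-apply-there c mv {i} i≢ = trans (at-apply c mv i) (look-ʳ++-there (lft c) (rgt c) i i≢)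

  at-apply-same : ∀ c {s w} mv → w ≡ at c (pos c) → ∀ i → at (apply M c (s , w , mv)) i ≡ at c i
  at-apply-same c mv eq i with i ≟ pos c
  ... | yes refl = trans (at-apply-here c mv) eq
  ... | no  i≢   = at-apply-there c mv i≢

  pos-apply-≤ : ∀ c {s w} mv → pos (apply M c (s , w , mv)) ≤ suc (pos c)
  pos-apply-≤ c {s} {w} mv = subst (_≤ suc (pos c)) (sym (pos-apply c mv)) (moved-≤ mv)
    where
    moved-≤ : ∀ mv → moved mv (pos c) ≤ suc (pos c)
    moved-≤ left  = ≤-trans pred[n]≤n (n≤1+n _)
    moved-≤ right = ≤-refl
    moved-≤ stay  = n≤1+n _

  -- `step` ignores `δ` in the halting states; emptying the list there gives `step≡` one form for
  -- all states.
  moves : State M → Sym M → List (State M × Sym M × Move)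
  moves zero                h = NTM.δ M zero h
  moves (suc zero)          h = []
  moves (suc (suc zero))    h = []
  moves s@(suc (suc (suc _))) h = NTM.δ M s h

  step≡ : ∀ c → step M c ≡ map (apply M c) (moves (st c) (at c (pos c)))
  step≡ c@(conf zero l h r)                rewrite sym (hd≡at c) = refl
  step≡ (conf (suc zero) l h r)          = refl
  step≡ (conf (suc (suc zero)) l h r)    = refl
  step≡ c@(conf (suc (suc (suc _))) l h r) rewrite sym (hd≡at c) = refl

  accept : State M
  accept = suc zero

  accPaths-suc : ∀ t c → st c ≢ accept → accPaths M (suc t) c ≡ sum (map (accPaths M t) (step M c))
  accPaths-suc t (conf zero l h r)                s≢ = refl
  accPaths-suc t (conf (suc zero) l h r)          s≢ = ⊥-elim (s≢ refl)
  accPaths-suc t (conf (suc (suc zero)) l h r)    s≢ = refl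
  accPaths-suc t (conf (suc (suc (suc _))) l h r) s≢ = refl

  accPaths-accept : ∀ t c → st c ≡ accept → accPaths M t c ≡ 1
  accPaths-accept t (conf _ l h r) refl = refl

  halted : ∀ c → Halted M c → st c ≢ accept → moves (st c) (at c (pos c)) ≡ [] × accPaths M 0 c ≡ 0
  halted _ h-acc s≢ = ⊥-elim (s≢ refl)
  halted _ h-rej s≢ = refl , refl

  Finishes-suc : ∀ t c → Finishes M t c → Finishes M (suc t) c
  Finishes-suc zero    c h         = inj₁ h
  Finishes-suc (suc t) c (inj₁ h)  = inj₁ h
  Finishes-suc (suc t) c (inj₂ fs) = inj₂ (All.map (λ {c′} → Finishes-suc t c′) fs)

  -- Extra time could only benefit a path cut off at time `t`, and `Finishes` excludes such paths.
  accPaths-stable : ∀ t c → Finishes M t c → accPaths M (suc t) c ≡ accPaths M t c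
  accPaths-stable-sum : ∀ t cs → All (Finishes M t) cs →
    sum (map (accPaths M (suc t)) cs) ≡ sum (map (accPaths M t) cs)
  accPaths-stable zero    _ h-acc        = refl
  accPaths-stable zero    _ h-rej        = refl
  accPaths-stable (suc t) _ (inj₁ h-acc) = refl
  accPaths-stable (suc t) _ (inj₁ h-rej) = refl
  accPaths-stable (suc t) c@(conf zero l h r)             (inj₂ fs) = accPaths-stable-sum t (step M c) fs
  accPaths-stable (suc t) (conf (suc zero) l h r)         (inj₂ fs) = refl
  accPaths-stable (suc t) (conf (suc (suc zero)) l h r)   (inj₂ fs) = refl
  accPaths-stable (suc t) c@(conf (suc (suc (suc _))) l h r) (inj₂ fs) = accPaths-stable-sum t (step M c) fs
  accPaths-stable-sum t []       []       = refl
  accPaths-stable-sum t (c ∷ cs) (f ∷ fs) = cong₂ _+_ (accPaths-stable t c f) (accPaths-stable-sum t cs fs)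

  Finishes-children : ∀ t c → Finishes M (suc t) c → All (Finishes M t) (step M c)
  Finishes-children t c (inj₁ h-acc) = []
  Finishes-children t c (inj₁ h-rej) = []
  Finishes-children t c (inj₂ fs)    = fs

  -- Termination and count are kept together because padding the time, as in `Counts-≤`, preserves
  -- the count only for paths that have ended.
  Counts : ℕ → Config M → ℕ → Set
  Counts t c n = Finishes M t c × accPaths M t c ≡ n

  Counts-≤ : ∀ {t t′ c n} → t ≤ t′ → Counts t c n → Counts t′ c n
  Counts-≤ {t} {t′} {c} {n} t≤t′ ct =
    subst (λ t → Counts t c n) (m∸n+n≡m t≤t′) (go (t′ ∸ t))
    where
    go : ∀ d → Counts (d + t) c n
    go zero    = ct
    go (suc d) with fin , eq ← go d =
      Finishes-suc (d + t) c fin , trans (accPaths-stable (d + t) c fin) eq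

  Counts-accept : ∀ t c → st c ≡ accept → Counts t c 1
  Counts-accept zero    (conf _ _ _ _) refl = h-acc , refl
  Counts-accept (suc t) (conf _ _ _ _) refl = inj₁ h-acc , refl

  SumCounts : ℕ → List (Config M) → ℕ → Set
  SumCounts t cs n = All (Finishes M t) cs × sum (map (accPaths M t) cs) ≡ n

  SumCounts-∷ : ∀ {t c cs m n} → Counts t c m → SumCounts t cs n → SumCounts t (c ∷ cs) (m + n)
  SumCounts-∷ (f , eq) (fs , eqs) = f ∷ fs , cong₂ _+_ eq eqs

  SumCounts-++ : ∀ {t} cs {ds m n} → SumCounts t cs m → SumCounts t ds n → SumCounts t (cs ++ ds) (m + n)
  SumCounts-++ {t} cs {ds} (fs , eq) (gs , eq′) =
    All.++⁺ fs gs ,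
    trans (cong sum (map-++ (accPaths M t) cs ds))
          (trans (sum-++ (map (accPaths M t) cs) _) (cong₂ _+_ eq eq′))

  SumCounts-map : ∀ {A : Set} {P : A → Set} {t} {f : A → Config M} {g : A → ℕ} {xs} →
    (∀ {x} → P x → Counts t (f x) (g x)) → All P xs → SumCounts t (map f xs) (sum (map g xs))
  SumCounts-map h []       = [] , refl
  SumCounts-map h (p ∷ ps) = SumCounts-∷ (h p) (SumCounts-map h ps)

  Counts-suc : ∀ {t c ms n} → st c ≢ accept → moves (st c) (at c (pos c)) ≡ ms →
               SumCounts t (map (apply M c) ms) n → Counts (suc t) c n
  Counts-suc {t} {c} {n = n} s≢ refl sc
    with fs , eq ← subst (λ cs → SumCounts t cs n) (sym (step≡ c)) sc
    = inj₂ fs , trans (accPaths-suc t c s≢) eq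

  Counts-det : ∀ {t c m n} → st c ≢ accept → moves (st c) (at c (pos c)) ≡ m ∷ [] →
               Counts t (apply M c m) n → Counts (suc t) c n
  Counts-det s≢ eq (f , e) = Counts-suc s≢ eq (f ∷ [] , trans (+-identityʳ _) e)

-- Control states and tape symbols of the simulating machine.

clip : ∀ {B} → ℕ → Fin (suc B)
clip {B} n = fromℕ< (s≤s (m⊓n≤n n B))

-- States are written with plain naturals. Those met in the correctness proof are at most `B`, so
-- there the truncation never takes effect.
toℕ-clip : ∀ {B n} → n ≤ B → toℕ (clip {B} n) ≡ n
toℕ-clip {B} n≤B = trans (toℕ-fromℕ< _) (m≤n⇒m⊓n≡m n≤B)

drop-suc : ∀ {A : Set} u (xs : List A) {y ys} → drop u xs ≡ y ∷ ys → drop (suc u) xs ≡ ys × suc u ≤ length xs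
drop-suc zero    (x ∷ xs) refl = refl , s≤s z≤n
drop-suc (suc u) (x ∷ xs) eq with p , q ← drop-suc u xs eq = p , s≤s q

-- run s u j ρ: N is in state s, only its moves from the u-th on are still to be
-- considered, j + 1 paths of the set pass through the current configuration and use
-- the tracks ρ, …, ρ + j.  rewind m and scan m search for the mark on track m.
data Control (s b : ℕ) : Set where
  run         : Fin s → (u j ρ : Fin b) → Control s b
  rewind scan : Fin b → Control s b

-- The arguments s, u, j of the run to be resumed; ρ follows from j and the track.
Mark : ℕ → ℕ → Set
Mark s b = Fin s × Fin b × Fin b

Track : ℕ → ℕ → ℕ → Set
Track s y b = Fin y × Maybe (Mark s b)

-- A written cell holds a left-end flag and one entry per track. Decoding after encoding is all that
-- is asked, and only pointwise, so that no extensionality is called for.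
record CellCode (A : Set) (b : ℕ) : Set where
  field
    size       : ℕ
    pack       : Bool → (Fin b → A) → Fin size
    flag       : Fin size → Bool
    entry      : Fin size → Fin b → A
    flag-pack  : ∀ l f → flag (pack l f) ≡ l
    entry-pack : ∀ l f i → entry (pack l f) i ≡ f i

-- The machine that follows a set of accepting paths.

module Subsets (N : NTM) (plan : List ℕ) (B : ℕ) {q′ : ℕ}
  (control : Control (3 + NTM.q N) (suc B) ↪ Fin q′)
  (cells   : CellCode (Track (3 + NTM.q N) (3 + NTM.g N) (suc B)) (suc B))
  where

  open CellCode cells

  State′ Sym′ Trk : Set
  State′ = Fin (3 + q′)
  Sym′   = Fin (3 + size)
  Trk    = Track (3 + NTM.q N) (3 + NTM.g N) (suc B)

  Rec : Set
  Rec = Mark (3 + NTM.q N) (suc B)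

  module N = Semantics N

  -- A head at the left end cannot notice it, so a rewind needs a flag to stop at. The first step
  -- flags cell 0, and every later write copies the flag of the scanned cell.
  isLeft : Sym′ → Bool
  isLeft zero                = false
  isLeft (suc zero)          = false
  isLeft (suc (suc zero))    = false
  isLeft (suc (suc (suc x))) = flag x

  -- A symbol the machine has not yet written stands for equal contents on all tracks.
  track : Sym′ → ℕ → Trk
  track zero                m = zero , nothing
  track (suc zero)          m = suc zero , nothing
  track (suc (suc zero))    m = suc (suc zero) , nothing
  track (suc (suc (suc x))) m = entry x (clip m)

  cell : Bool → (ℕ → Trk) → Sym′
  cell l f = suc (suc (suc (pack l (f ∘ toℕ))))

  track-cell : ∀ l f {m} → m ≤ B → track (cell l f) m ≡ f m
  track-cell l f m≤B = trans (entry-pack l (f ∘ toℕ) _) (cong f (toℕ-clip m≤B))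

  control′ : Control (3 + NTM.q N) (suc B) → State′
  control′ x = suc (suc (suc (RightInverse.to control x)))

  running : State N → (u j ρ : ℕ) → State′
  running s u j ρ = control′ (run s (clip u) (clip j) (clip ρ))

  rewinding scanning : ℕ → State′
  rewinding m = control′ (rewind (clip m))
  scanning  m = control′ (scan (clip m))

  -- The tracks below `ρ` work as a stack of waiting groups. An empty stack means that the whole set
  -- has been followed; otherwise the topmost waiting track carries the mark of the group to resume.
  resume : ℕ → State′
  resume zero    = suc zero
  resume (suc m) = rewinding m

  -- Tracks ρ, …, ρ′ - 1 stop being written and the topmost of them gets the mark.
  -- All tracks from ρ′ on are overwritten, including those of finished paths.
  freeze : (ρ ρ′ : ℕ) → Rec → Sym N → ℕ → Trk → Trk
  freeze ρ ρ′ r w m (x , k) =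
    (if does (ρ′ ≤? m) then w else x) ,
    -- If `ρ′` equals `ρ`, no path is left behind; the second test then protects the mark of an
    -- older group on the track just below `ρ`.
    (if does (suc m ≟ ρ′) ∧ does (ρ ≤? m) then just r else k)

  -- suc a paths take the move, b take a later one.
  option : State N → (u ρ : ℕ) → Sym′ → State N × Sym N × Move → ℕ × ℕ → State′ × Sym′ × Move
  option s u ρ γ (s′ , w , mv) (a , b) =
    running s′ 0 a (ρ + b) ,
    -- A run over b paths stores b - 1, whence `pred`. For b = 0 the record is a dummy that `freeze`
    -- does not write.
    cell (isLeft γ) (λ m → freeze ρ (ρ + b) (s , clip (suc u) , clip (pred b)) w m (track γ m)) ,
    mv

  -- Moves that no path of the set takes are passed over within one step, so each option advances at
  -- least one path. Every distribution of the set arises from exactly one sequence of options.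
  options : State N → (u j ρ : ℕ) → Sym′ → List (State N × Sym N × Move) → List (State′ × Sym′ × Move)
  options s u j ρ γ []       = []
  options s u j ρ γ (m ∷ ms) = map (option s u ρ γ m) (splits j) ++ options s (suc u) j ρ γ ms

  -- Only one path ends in a given accepting configuration node, so a demand for two or more is a
  -- dead end. Elsewhere the active tracks agree, and the lowest one is read.
  runMoves : State N → (u j ρ : ℕ) → Sym′ → List (State′ × Sym′ × Move)
  runMoves (suc zero) u zero    ρ γ = (resume ρ , γ , stay) ∷ []
  runMoves (suc zero) u (suc j) ρ γ = []
  runMoves s          u j       ρ γ = options s u j ρ γ (drop u (N.moves s (proj₁ (track γ ρ))))

  found : ℕ → Maybe Rec → Sym′ → State′ × Sym′ × Move
  found m nothing            γ = scanning m , γ , right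
  found m (just (s , u , j)) γ = running s (toℕ u) (toℕ j) (m ∸ toℕ j) , γ , stay

  controlMoves : Control (3 + NTM.q N) (suc B) → Sym′ → List (State′ × Sym′ × Move)
  controlMoves (run s u j ρ) γ = runMoves s (toℕ u) (toℕ j) (toℕ ρ) γ
  controlMoves (rewind m)    γ =
    (if isLeft γ then (control′ (scan m) , γ , stay) else (control′ (rewind m) , γ , left)) ∷ []
  controlMoves (scan m)      γ = found (toℕ m) (proj₂ (track γ (toℕ m))) γ ∷ []

  machine : NTM
  machine = record { q = q′ ; g = size ; δ = δ }
    where
    δ : State′ → Sym′ → List (State′ × Sym′ × Move)
    -- Repeated entries of the plan are distinct choices, which realises the weights. The write also
    -- sets the left-end flag.
    δ zero                γ = map (λ i → running zero 0 i 0 , cell true (track γ) , stay) plan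
    δ (suc zero)          γ = []
    δ (suc (suc zero))    γ = []
    δ (suc (suc (suc x))) γ = controlMoves (RightInverse.from control x) γ

  module P = Semantics machine
  open P using (st; at; pos; Counts; SumCounts)

  control-moves : ∀ x γ → P.moves (control′ x) γ ≡ controlMoves x γ
  control-moves x γ = cong (λ x → controlMoves x γ) (RightInverse.strictlyInverseʳ control x)

  running-moves : ∀ s {u j ρ} γ → u ≤ B → j ≤ B → ρ ≤ B →
                  P.moves (running s u j ρ) γ ≡ runMoves s u j ρ γ
  running-moves s {u} {j} {ρ} γ u≤B j≤B ρ≤B = trans (control-moves _ γ) eq
    where
    eq : runMoves s (toℕ (clip {B} u)) (toℕ (clip {B} j)) (toℕ (clip {B} ρ)) γ ≡ runMoves s u j ρ γ
    eq rewrite toℕ-clip {B} u≤B | toℕ-clip {B} j≤B | toℕ-clip {B} ρ≤B = refl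

  rewinding-moves : ∀ m γ {l} → isLeft γ ≡ l →
    P.moves (rewinding m) γ ≡ (if l then (scanning m , γ , stay) else (rewinding m , γ , left)) ∷ []
  rewinding-moves m γ refl = control-moves _ γ

  scanning-moves : ∀ {m} γ {r} → m ≤ B → proj₂ (track γ m) ≡ r →
                   P.moves (scanning m) γ ≡ found m r γ ∷ []
  scanning-moves {m} γ m≤B refl = trans (control-moves _ γ)
    (cong (λ m → found m (proj₂ (track γ m)) γ ∷ []) (toℕ-clip m≤B))

  runMoves-options : ∀ s {u j ρ} γ → s ≢ N.accept →
    runMoves s u j ρ γ ≡ options s u j ρ γ (drop u (N.moves s (proj₁ (track γ ρ))))
  runMoves-options zero          γ s≢ = refl
  runMoves-options (suc zero)    γ s≢ = ⊥-elim (s≢ refl)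
  runMoves-options (suc (suc s)) γ s≢ = refl

  freeze-≥ : ∀ {ρ ρ′ r w m} x → ρ′ ≤ m → freeze ρ ρ′ r w m x ≡ (w , proj₂ x)
  freeze-≥ {ρ} {ρ′} {m = m} x ρ′≤m
    rewrite dec-true (ρ′ ≤? m) ρ′≤m
          | dec-false (suc m ≟ ρ′) (λ eq → <-irrefl (sym eq) (s≤s ρ′≤m)) = refl

  freeze-< : ∀ {ρ ρ′ r w m} x → m < ρ′ → proj₁ (freeze ρ ρ′ r w m x) ≡ proj₁ x
  freeze-< {ρ} {ρ′} {m = m} x m<ρ′ rewrite dec-false (ρ′ ≤? m) (<⇒≱ m<ρ′) = refl

  freeze-top : ∀ {ρ ρ′ r w m} x → ρ ≤ m → suc m ≡ ρ′ → proj₂ (freeze ρ ρ′ r w m x) ≡ just r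
  freeze-top {ρ} {ρ′} {m = m} x ρ≤m eq
    rewrite dec-true (suc m ≟ ρ′) eq | dec-true (ρ ≤? m) ρ≤m = refl

  freeze-mid : ∀ {ρ ρ′ r w m} x → suc m < ρ′ → freeze ρ ρ′ r w m x ≡ x
  freeze-mid {ρ} {ρ′} {m = m} x m<ρ′
    rewrite dec-false (ρ′ ≤? m) (<⇒≱ (<-trans (n<1+n m) m<ρ′))
          | dec-false (suc m ≟ ρ′) (λ eq → <-irrefl eq m<ρ′) = refl

  freeze-below : ∀ {ρ ρ′ r w m} x → m < ρ → m < ρ′ → freeze ρ ρ′ r w m x ≡ x
  freeze-below {ρ} {ρ′} {m = m} x m<ρ m<ρ′
    rewrite dec-false (ρ′ ≤? m) (<⇒≱ m<ρ′) | dec-false (ρ ≤? m) (<⇒≱ m<ρ)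
    with does (suc m ≟ ρ′)
  ... | true  = refl
  ... | false = refl

  goto : Config machine → State′ → Move → Config machine
  goto C s mv = apply machine C (s , at C (pos C) , mv)

  at-goto : ∀ C s mv i → at (goto C s mv) i ≡ at C i
  at-goto C s mv = P.at-apply-same C mv refl

  st-goto : ∀ C s mv → st (goto C s mv) ≡ s
  st-goto C s mv = P.st-apply C {s} {at C (pos C)} mv

  pos-goto : ∀ C s mv → pos (goto C s mv) ≡ P.moved mv (pos C)
  pos-goto C s mv = P.pos-apply C {s} {at C (pos C)} mv

  -- The invariant and the search for a mark.

  LeftMarked : Config machine → Set
  LeftMarked C = isLeft (at C 0) ≡ true × (∀ i → isLeft (at C (suc i)) ≡ false)

  LeftMarked-≗ : ∀ C C′ → (∀ i → at C′ i ≡ at C i) → LeftMarked C → LeftMarked C′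
  LeftMarked-≗ C C′ eq (l₀ , l₊) = trans (cong isLeft (eq 0)) l₀ , λ i → trans (cong isLeft (eq (suc i))) (l₊ i)

  -- The tracks ρ, …, ρ + j all hold the tape of c; the ones above are garbage, the
  -- ones below belong to configurations waiting to be resumed.
  record Active (C : Config machine) (c : Config N) (j ρ : ℕ) : Set where
    field
      bound    : ρ + j ≤ B
      head     : pos C ≡ N.pos c
      contents : ∀ {m} → ρ ≤ m → m ≤ ρ + j → ∀ i → proj₁ (track (at C i) m) ≡ N.at c i
      -- Strict, because the top track may still hold the mark by which its group was resumed. That
      -- mark is harmless: the top track always goes with the move taken, so it is never searched
      -- again.
      unmarked : ∀ {m} → ρ ≤ m → m < ρ + j → ∀ i → proj₂ (track (at C i) m) ≡ nothing
      edge     : LeftMarked C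

  open Active

  module Run (T : ℕ) where

    AgreeBelow : ℕ → Config machine → Config machine → Set
    AgreeBelow ρ C C′ = ∀ {m} → m < ρ → ∀ i → track (at C′ i) m ≡ track (at C i) m

    -- The continuation of C after its active paths have accepted, whatever they have
    -- done to the tracks from ρ on.
    Resumes : ℕ → Config machine → ℕ → ℕ → Set
    Resumes ρ C τ n = ∀ C′ → st C′ ≡ resume ρ → pos C′ ≤ T → LeftMarked C′ → AgreeBelow ρ C C′ → Counts τ C′ n

    Resumes-agree : ∀ {ρ C C₁ τ n} → AgreeBelow ρ C C₁ → Resumes ρ C τ n → Resumes ρ C₁ τ n
    Resumes-agree ag k C′ s p l ag′ = k C′ s p l (λ m<ρ i → trans (ag′ m<ρ i) (ag m<ρ i))

    control≢accept : ∀ {C : Config machine} {x} → st C ≡ control′ x → st C ≢ P.accept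
    control≢accept refl ()

    -- Induction on the distance to cell 0; the extra step is the change to scanning. The rest of
    -- the computation enters as a continuation.
    rewind-count : ∀ p {C m τ n} → pos C ≡ p → st C ≡ rewinding m → LeftMarked C →
      (∀ C′ → st C′ ≡ scanning m → pos C′ ≡ 0 → (∀ i → at C′ i ≡ at C i) → Counts τ C′ n) →
      Counts (suc p + τ) C n
    rewind-count zero {C} {m} p≡ s≡ (l₀ , l₊) k =
      P.Counts-det (control≢accept {C} s≡)
        (trans (cong (λ s → P.moves s (at C (pos C))) s≡)
               (rewinding-moves m (at C (pos C)) (trans (cong (isLeft ∘ at C) p≡) l₀)))
        (k (goto C (scanning m) stay) (st-goto C (scanning m) stay) (trans (pos-goto C (scanning m) stay) p≡)
           (at-goto C (scanning m) stay))
    rewind-count (suc p) {C} {m} p≡ s≡ l@(l₀ , l₊) k =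
      P.Counts-det (control≢accept {C} s≡)
        (trans (cong (λ s → P.moves s (at C (pos C))) s≡)
               (rewinding-moves m (at C (pos C)) (trans (cong (isLeft ∘ at C) p≡) (l₊ p))))
        (rewind-count p {goto C (rewinding m) left} (trans (pos-goto C (rewinding m) left) (cong pred p≡)) (st-goto C (rewinding m) left)
          (LeftMarked-≗ C (goto C (rewinding m) left) same l)
          (λ C′ s p eq → k C′ s p (λ i → trans (eq i) (same i))))
      where
      same : ∀ i → at (goto C (rewinding m) left) i ≡ at C i
      same = at-goto C (rewinding m) left

    scan-count : ∀ d p {C m s u j τ n} → pos C + d ≡ p → st C ≡ scanning m → m ≤ B →
      (∀ i → i < p → proj₂ (track (at C i) m) ≡ nothing) →
      proj₂ (track (at C p) m) ≡ just (s , u , j) →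
      (∀ C′ → st C′ ≡ running s (toℕ u) (toℕ j) (m ∸ toℕ j) → pos C′ ≡ p → (∀ i → at C′ i ≡ at C i) →
        Counts τ C′ n) →
      Counts (suc d + τ) C n
    scan-count zero p {C} {m} {s} {u} {j} p≡ s≡ m≤B none here k =
      P.Counts-det (control≢accept {C} s≡)
        (trans (cong (λ s → P.moves s (at C (pos C))) s≡)
               (scanning-moves (at C (pos C)) m≤B (trans (cong (λ i → proj₂ (track (at C i) m)) q≡) here)))
        (k (goto C next stay) (st-goto C next stay) (trans (pos-goto C next stay) q≡) (at-goto C next stay))
      where
      next : State′
      next = running s (toℕ u) (toℕ j) (m ∸ toℕ j)
      q≡ : pos C ≡ p
      q≡ = trans (sym (+-identityʳ _)) p≡
    scan-count (suc d) p {C} {m} p≡ s≡ m≤B none here k =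
      P.Counts-det (control≢accept {C} s≡)
        (trans (cong (λ s → P.moves s (at C (pos C))) s≡)
               (scanning-moves (at C (pos C)) m≤B (none (pos C) q<p)))
        (scan-count d p {goto C (scanning m) right} (trans (cong (_+ d) (pos-goto C (scanning m) right)) (trans (sym (+-suc (pos C) d)) p≡))
          (st-goto C (scanning m) right) m≤B
          (λ i i<p → trans (cong (λ γ → proj₂ (track γ m)) (same i)) (none i i<p))
          (trans (cong (λ γ → proj₂ (track γ m)) (same p)) here)
          (λ C′ s p eq → k C′ s p (λ i → trans (eq i) (same i))))
      where
      q<p : pos C < p
      q<p = subst (pos C <_) p≡ (m<m+n (pos C) (s≤s z≤n))
      same : ∀ i → at (goto C (scanning m) right) i ≡ at C i
      same = at-goto C (scanning m) right

    -- One rewind and one scan, each over at most `T` cells plus one step that changes the state.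
    seekTime : ℕ
    seekTime = suc T + suc T

    seek-count : ∀ {C m p s u j τ n} → st C ≡ rewinding m → pos C ≤ T → LeftMarked C → m ≤ B → p ≤ T →
      (∀ i → i < p → proj₂ (track (at C i) m) ≡ nothing) →
      proj₂ (track (at C p) m) ≡ just (s , u , j) →
      (∀ C′ → st C′ ≡ running s (toℕ u) (toℕ j) (m ∸ toℕ j) → pos C′ ≡ p → (∀ i → at C′ i ≡ at C i) →
        Counts τ C′ n) →
      Counts (seekTime + τ) C n
    seek-count {C} {m} {p} {τ = τ} s≡ q≤T l m≤B p≤T none here k =
      P.Counts-≤ (subst (suc (pos C) + (suc p + τ) ≤_) (sym (+-assoc (suc T) (suc T) τ))
                   (+-mono-≤ (s≤s q≤T) (+-monoˡ-≤ τ (s≤s p≤T))))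
        (rewind-count (pos C) refl s≡ l λ C₁ s₁ p₁ eq₁ →
          scan-count p p (cong (_+ p) p₁) s₁ m≤B
            (λ i i<p → trans (cong (λ γ → proj₂ (track γ m)) (eq₁ i)) (none i i<p))
            (trans (cong (λ γ → proj₂ (track γ m)) (eq₁ p)) here)
            (λ C₂ s₂ p₂ eq₂ → k C₂ s₂ p₂ (λ i → trans (eq₂ i) (eq₁ i))))

    -- Counting the sets of accepting paths, with time bounds.

    -- j + 1 paths of length at most t each, and a search after each of the first j.
    cost : ℕ → ℕ → ℕ
    cost j t = suc j * suc t + j * seekTime

    -- The predecessor of cost j (suc t).
    cost⁻ : ℕ → ℕ → ℕ
    cost⁻ j t = suc t + j * suc (suc t) + j * seekTime

    -- A product, because each set of accepting paths hands over to the same continuation, worth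
    -- `n`. The bound on `N.pos c + t` keeps the head within the reach of a search.
    RunCounts : ℕ → Set
    RunCounts t = ∀ {c C j ρ τ n} → Finishes N t c → N.pos c + t ≤ T → Active C c j ρ →
      st C ≡ running (N.st c) 0 j ρ → Resumes ρ C τ n →
      Counts (cost j t + τ) C (accPaths N t c choose suc j * n)

    -- Of the `a + suc b` searches, `a` fall in the first group, `b` in the second and one in
    -- between. Each of the `suc a` paths of the first group is one step shorter; paying for the
    -- current step leaves a slack of `a`.
    cost-children : ∀ a b t → cost a t + (seekTime + cost b (suc t)) ≤ cost⁻ (a + suc b) t
    cost-children a b t = m+n≤o⇒m≤o _ (≤-reflexive (eq a b t seekTime))
      where
      eq : ∀ a b t s →
        suc a * suc t + a * s + (s + (suc b * suc (suc t) + b * s)) + a ≡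
        suc t + (a + suc b) * suc (suc t) + (a + suc b) * s
      eq = solve 4 (λ a b t s →
          (con 1 :+ a) :* (con 1 :+ t) :+ a :* s :+
            (s :+ ((con 1 :+ b) :* (con 2 :+ t) :+ b :* s)) :+ a :=
          con 1 :+ t :+ (a :+ (con 1 :+ b)) :* (con 2 :+ t) :+ (a :+ (con 1 :+ b)) :* s) refl
        where open +-*-Solver

    cost-child : ∀ a t → cost a t ≤ cost⁻ a t
    cost-child a t = +-monoˡ-≤ (a * seekTime) (+-monoʳ-≤ (suc t) (*-monoʳ-≤ a (n≤1+n (suc t))))

    -- The machine takes one option at `C` while `N` takes the move at `c`. Tracks `ρ + b` to
    -- `ρ + j` follow `N`; the `b` tracks below them keep the tape of `c`.
    module Branch {C c j ρ} (A : Active C c j ρ) (s : State N) (u : ℕ)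
                  (s′ : State N) (w : Sym N) (mv : Move) {a b} (a+b≡j : a + b ≡ j) where

      γ : Sym′
      γ = at C (pos C)

      r : Rec
      r = s , clip (suc u) , clip (pred b)

      γ₁ : Sym′
      γ₁ = cell (isLeft γ) (λ m → freeze ρ (ρ + b) r w m (track γ m))

      C₁ : Config machine
      C₁ = apply machine C (option s u ρ γ (s′ , w , mv) (a , b))

      c₁ : Config N
      c₁ = apply N c (s′ , w , mv)

      ρ+b+a : ρ + b + a ≡ ρ + j
      ρ+b+a = trans (+-assoc ρ b a) (cong (ρ +_) (trans (+-comm b a) a+b≡j))

      ρ+b≤ρ+j : ρ + b ≤ ρ + j
      ρ+b≤ρ+j = m+n≤o⇒m≤o (ρ + b) (≤-reflexive ρ+b+a)

      ≤B : ∀ {m} → m ≤ ρ + j → m ≤ B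
      ≤B m≤ = ≤-trans m≤ (bound A)

      here : at C₁ (pos C) ≡ γ₁
      here = P.at-apply-here C mv

      there : ∀ {i} → i ≢ pos C → at C₁ i ≡ at C i
      there = P.at-apply-there C mv

      track-here : ∀ {m} → m ≤ ρ + j → track (at C₁ (pos C)) m ≡ freeze ρ (ρ + b) r w m (track γ m)
      track-here {m} m≤ = trans (cong (λ γ → track γ m) here) (track-cell _ _ (≤B m≤))

      track-there : ∀ {i} m → i ≢ pos C → track (at C₁ i) m ≡ track (at C i) m
      track-there m i≢ = cong (λ γ → track γ m) (there i≢)

      state₁ : st C₁ ≡ running (N.st c₁) 0 a (ρ + b)
      state₁ = trans (P.st-apply C mv) (cong (λ s → running s 0 a (ρ + b)) (sym (N.st-apply c mv)))

      edge₁ : LeftMarked C₁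
      edge₁ = trans (same 0) (proj₁ (edge A)) , λ i → trans (same (suc i)) (proj₂ (edge A) i)
        where
        same : ∀ i → isLeft (at C₁ i) ≡ isLeft (at C i)
        same i with i ≟ pos C
        ... | yes refl = trans (cong isLeft here) (flag-pack (isLeft γ) _)
        ... | no  i≢   = cong isLeft (there i≢)

      active₁ : Active C₁ c₁ a (ρ + b)
      active₁ = record
        { bound    = ≤-trans (≤-reflexive ρ+b+a) (bound A)
        ; head     = trans (P.pos-apply C mv)
                       (trans (cong (P.moved mv) (head A)) (trans (moved≡ mv) (sym (N.pos-apply c mv))))
        ; contents = contents₁
        ; unmarked = unmarked₁
        ; edge     = edge₁
        }
        where
        moved≡ : ∀ mv → P.moved mv (N.pos c) ≡ N.moved mv (N.pos c)
        moved≡ left  = refl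
        moved≡ right = refl
        moved≡ stay  = refl
        contents₁ : ∀ {m} → ρ + b ≤ m → m ≤ ρ + b + a → ∀ i → proj₁ (track (at C₁ i) m) ≡ N.at c₁ i
        contents₁ {m} ≤m m≤ i with i ≟ pos C
        ... | yes refl =
          trans (cong proj₁ (trans (track-here (≤-trans m≤ (≤-reflexive ρ+b+a))) (freeze-≥ {ρ} (track γ m) ≤m)))
                (sym (trans (cong (N.at c₁) (head A)) (N.at-apply-here c mv)))
        ... | no i≢ =
          trans (cong proj₁ (track-there m i≢))
            (trans (contents A (m+n≤o⇒m≤o ρ ≤m) (≤-trans m≤ (≤-reflexive ρ+b+a)) i)
                   (sym (N.at-apply-there c mv (λ i≡ → i≢ (trans i≡ (sym (head A)))))))
        unmarked₁ : ∀ {m} → ρ + b ≤ m → m < ρ + b + a → ∀ i → proj₂ (track (at C₁ i) m) ≡ nothing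
        unmarked₁ {m} ≤m m< i with i ≟ pos C
        ... | yes refl =
          trans (cong proj₂ (trans (track-here (<⇒≤ m<ρ+j)) (freeze-≥ {ρ} (track γ m) ≤m)))
                (unmarked A (m+n≤o⇒m≤o ρ ≤m) m<ρ+j (pos C))
          where
          m<ρ+j : m < ρ + j
          m<ρ+j = ≤-trans m< (≤-reflexive ρ+b+a)
        ... | no i≢ =
          trans (cong proj₂ (track-there m i≢))
                (unmarked A (m+n≤o⇒m≤o ρ ≤m) (≤-trans m< (≤-reflexive ρ+b+a)) i)

      content-kept : ∀ {m} → m < ρ + b → ∀ i → proj₁ (track (at C₁ i) m) ≡ proj₁ (track (at C i) m)
      content-kept {m} m< i with i ≟ pos C
      ... | yes refl = trans (cong proj₁ (track-here (≤-trans (<⇒≤ m<) ρ+b≤ρ+j))) (freeze-< {ρ} {r = r} {w} (track γ m) m<)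
      ... | no  i≢   = cong proj₁ (track-there m i≢)

      below-kept : AgreeBelow ρ C C₁
      below-kept {m} m<ρ i with i ≟ pos C
      ... | yes refl = trans (track-here (≤-trans (<⇒≤ m<ρ) (m≤m+n ρ j)))
                             (freeze-below (track γ m) m<ρ (≤-trans m<ρ (m≤m+n ρ b)))
      ... | no  i≢   = track-there m i≢

      mid-kept : ∀ {m} → suc m < ρ + b → ∀ i → track (at C₁ i) m ≡ track (at C i) m
      mid-kept {m} m< i with i ≟ pos C
      ... | yes refl = trans (track-here (≤-trans (≤-trans (n≤1+n m) (<⇒≤ m<)) ρ+b≤ρ+j))
                             (freeze-mid {ρ} (track γ m) m<)
      ... | no  i≢   = track-there m i≢

      -- Nothing below track `ρ + b` has changed since the separation, so the mark is still in its
      -- cell. The search cannot stop before it: track `ρ + b′` was not the top track at `C`, hence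
      -- unmarked everywhere.
      resume-count : ∀ {b′} → b ≡ suc b′ → N.pos c ≤ T → suc u ≤ B → ∀ {C′ τ n} →
        st C′ ≡ rewinding (ρ + b′) → pos C′ ≤ T → LeftMarked C′ → AgreeBelow (ρ + b) C₁ C′ →
        (∀ C″ → st C″ ≡ running s (suc u) b′ ρ → Active C″ c b′ ρ → AgreeBelow ρ C C″ → Counts τ C″ n) →
        Counts (seekTime + τ) C′ n
      resume-count {b′} refl p≤T u<B {C′} s≡ q≤T l agree k =
        seek-count {C′} {ρ + b′} {pos C} s≡ q≤T l (≤B top≤) (subst (_≤ T) (sym (head A)) p≤T)
          (λ i i< → trans (cong proj₂ (trans (agree top< i) (track-there (ρ + b′) (<⇒≢ i<))))
                          (unmarked A (m≤m+n ρ b′) (≤-trans top< ρ+b≤ρ+j) i))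
          (trans (cong proj₂ (trans (agree top< (pos C)) (track-here top≤)))
                 (freeze-top {ρ} {ρ + suc b′} {r} {w} (track γ (ρ + b′)) (m≤m+n ρ b′) (sym (+-suc ρ b′))))
          (λ C″ s″ p″ eq → k C″ (trans s″ state≡) (active″ C″ p″ eq)
            (λ {m} m<ρ i → trans (cong (λ γ → track γ m) (eq i))
              (trans (agree (≤-trans m<ρ (m≤m+n ρ (suc b′))) i) (below-kept m<ρ i))))
        where
        top< : ρ + b′ < ρ + suc b′
        top< = ≤-reflexive (sym (+-suc ρ b′))
        top≤ : ρ + b′ ≤ ρ + j
        top≤ = ≤-trans (<⇒≤ top<) ρ+b≤ρ+j
        b′≤B : b′ ≤ B
        b′≤B = ≤B (≤-trans (m≤n+m b′ ρ) top≤)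
        state≡ : running s (toℕ (clip {B} (suc u))) (toℕ (clip {B} b′)) (ρ + b′ ∸ toℕ (clip {B} b′)) ≡
                 running s (suc u) b′ ρ
        state≡ rewrite toℕ-clip {B} u<B | toℕ-clip {B} b′≤B | m+n∸n≡m ρ b′ = refl
        active″ : ∀ C″ → pos C″ ≡ pos C → (∀ i → at C″ i ≡ at C′ i) → Active C″ c b′ ρ
        active″ C″ p″ eq = record
          { bound    = ≤B top≤
          ; head     = trans p″ (head A)
          ; contents = λ {m} ρ≤m m≤ i →
              let m< = ≤-trans (s≤s m≤) top< in
              trans (cong (λ γ → proj₁ (track γ m)) (eq i))
                (trans (cong proj₁ (agree m< i))
                  (trans (content-kept m< i) (contents A ρ≤m (≤-trans m≤ top≤) i)))
          ; unmarked = λ {m} ρ≤m m< i →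
              trans (cong (λ γ → proj₂ (track γ m)) (eq i))
                (trans (cong proj₂ (trans (agree (<-trans m< top<) i) (mid-kept (≤-trans (s≤s m<) top<) i)))
                       (unmarked A ρ≤m (≤-trans m< top≤) i))
          ; edge     = LeftMarked-≗ C′ C″ eq l
          }

    module _ (branching : ∀ s h → length (N.moves s h) ≤ B) where

      running-count : ∀ {c C j ρ u ms x v} → N.st c ≢ N.accept → Active C c j ρ →
        st C ≡ running (N.st c) u j ρ → u ≤ B → drop u (N.moves (N.st c) (N.at c (N.pos c))) ≡ ms →
        SumCounts x (map (apply machine C) (options (N.st c) u j ρ (at C (pos C)) ms)) v →
        Counts (suc x) C v
      running-count {c} {C} {j} {ρ} {u} s≢ A s≡ u≤B refl =
        P.Counts-suc (control≢accept {C} s≡)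
          (trans (cong (λ s → P.moves s γ) s≡)
          (trans (running-moves (N.st c) γ u≤B (m+n≤o⇒n≤o ρ (bound A)) (m+n≤o⇒m≤o ρ (bound A)))
          (trans (runMoves-options (N.st c) γ s≢)
                 (cong (λ h → options (N.st c) u j ρ γ (drop u (N.moves (N.st c) h))) read≡))))
        where
        γ : Sym′
        γ = at C (pos C)
        read≡ : proj₁ (track γ ρ) ≡ N.at c (N.pos c)
        read≡ = trans (contents A ≤-refl (m≤m+n ρ j) (pos C)) (cong (N.at c) (head A))

      -- Induction on the moves still open. For a split with waiting paths, the run behind the move
      -- gets as its continuation a search followed by this same statement for the later moves;
      -- passing over the move is the statement for the later moves at `C` itself. `vandermonde⁺`
      -- adds up the cases.
      options-count : ∀ {t} → RunCounts t → ∀ {c} → N.st c ≢ N.accept → N.pos c + suc t ≤ T →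
        ∀ ms {u} → drop u (N.moves (N.st c) (N.at c (N.pos c))) ≡ ms →
        All (Finishes N t) (map (apply N c) ms) →
        ∀ {C j ρ τ n} → Active C c j ρ → Resumes ρ C τ n →
        SumCounts (cost⁻ j t + τ)
          (map (apply machine C) (options (N.st c) u j ρ (at C (pos C)) ms))
          (sum (map (accPaths N t) (map (apply N c) ms)) choose suc j * n)
      options-count runs s≢ p≤T [] d≡ [] {j = j} {n = n} A k =
        [] , sym (cong (_* n) (k>n⇒nCk≡0 {0} {suc j} (s≤s z≤n)))
      options-count {t} runs {c} s≢ p≤T (m@(s′ , w , mv) ∷ ms) {u} d≡ (fin ∷ fins) {C} {j} {ρ} {τ} {n} A k
        with d≡′ , u<l ← drop-suc u (N.moves (N.st c) (N.at c (N.pos c))) d≡ =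
        subst₂ (SumCounts (cost⁻ j t + τ))
          (trans (cong (_++ map (apply machine C) (options (N.st c) (suc u) j ρ γ ms))
                       (map-∘ (splits j)))
                 (sym (map-++ (apply machine C) (map (option (N.st c) u ρ γ m) (splits j)) _)))
          value
          (P.SumCounts-++ (map (apply machine C ∘ option (N.st c) u ρ γ m) (splits j))
            (P.SumCounts-map split-count (splits-sum j))
            (options-count runs s≢ p≤T ms d≡′ fins A k))
        where
        γ : Sym′
        γ = at C (pos C)
        x y : ℕ
        x = accPaths N t (apply N c m)
        y = sum (map (accPaths N t) (map (apply N c) ms))
        u<B : suc u ≤ B
        u<B = ≤-trans u<l (branching (N.st c) (N.at c (N.pos c)))
        c≤T : N.pos c ≤ T
        c≤T = m+n≤o⇒m≤o _ p≤T
        p₁≤T : N.pos (apply N c m) + t ≤ T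
        p₁≤T = ≤-trans (+-monoˡ-≤ t (N.pos-apply-≤ c mv)) (≤-trans (≤-reflexive (sym (+-suc _ t))) p≤T)
        split-count : ∀ {ab} → proj₁ ab + proj₂ ab ≡ j →
          Counts (cost⁻ j t + τ) (apply machine C (option (N.st c) u ρ γ m ab))
                 (x choose suc (proj₁ ab) * (y choose proj₂ ab * n))
        -- No path waits, so the given continuation is used directly; the factor `y choose 0` is 1.
        split-count {a , zero} a+b≡j =
          P.Counts-≤ (+-monoˡ-≤ τ (subst (λ j → cost a t ≤ cost⁻ j t) (trans (sym (+-identityʳ a)) a+b≡j) (cost-child a t)))
            (runs fin p₁≤T active₁ state₁ λ C′ s≡ q≤T l agree →
              subst (Counts τ C′) (trans (sym (*-identityˡ n)) (cong (_* n) (sym (nC0≡1 y))))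
                (k C′ (trans s≡ (cong resume (+-identityʳ ρ))) q≤T l λ m<ρ i →
                  trans (agree (≤-trans m<ρ (m≤m+n ρ 0)) i) (below-kept m<ρ i)))
          where open Branch A (N.st c) u s′ w mv {a} {zero} a+b≡j
        split-count {a , suc b} a+b≡j =
          P.Counts-≤ time
            (runs fin p₁≤T active₁ state₁ λ C′ s≡ q≤T l agree →
              resume-count refl c≤T u<B {C′} (trans s≡ (cong resume (+-suc ρ b))) q≤T l agree λ C″ s″ A″ agree″ →
                running-count s≢ A″ s″ u<B d≡′
                  (options-count runs s≢ p≤T ms d≡′ fins A″ (Resumes-agree {C = C} {C″} agree″ k)))
          where
          open Branch A (N.st c) u s′ w mv {a} {suc b} a+b≡j
          time : cost a t + (seekTime + (cost b (suc t) + τ)) ≤ cost⁻ j t + τ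
          time = begin
            cost a t + (seekTime + (cost b (suc t) + τ))
              ≡⟨ cong (cost a t +_) (+-assoc seekTime (cost b (suc t)) τ) ⟨
            cost a t + (seekTime + cost b (suc t) + τ)
              ≡⟨ +-assoc (cost a t) (seekTime + cost b (suc t)) τ ⟨
            cost a t + (seekTime + cost b (suc t)) + τ
              ≤⟨ +-monoˡ-≤ τ (cost-children a b t) ⟩
            cost⁻ (a + suc b) t + τ
              ≡⟨ cong (λ j → cost⁻ j t + τ) a+b≡j ⟩
            cost⁻ j t + τ ∎
            where open ≤-Reasoning
        value : sum (map (λ (a , b) → x choose suc a * (y choose b * n)) (splits j)) + y choose suc j * n ≡
                (x + y) choose suc j * n
        value = begin
          convolve f (λ b → y choose b * n) j + y choose suc j * n
            ≡⟨ cong (_+ y choose suc j * n) (convolve-*ʳ f (y choose_) n j) ⟩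
          convolve f (y choose_) j * n + y choose suc j * n
            ≡⟨ *-distribʳ-+ n (convolve f (y choose_) j) (y choose suc j) ⟨
          (convolve f (y choose_) j + y choose suc j) * n
            ≡⟨ cong (_* n) (vandermonde⁺ x y j) ⟩
          (x + y) choose suc j * n ∎
          where
          open ≡-Reasoning
          f : ℕ → ℕ
          f a = x choose suc a

      -- The two accepting clauses of `runMoves` realise the values 1 and 0 of `1 choose suc j`.
      accept-count : ∀ {c C ρ τ n} t j → N.st c ≡ N.accept → N.pos c ≤ T → Active C c j ρ →
        st C ≡ running (N.st c) 0 j ρ → Resumes ρ C τ n →
        Counts (cost j t + τ) C (1 choose suc j * n)
      accept-count {c} {C} {ρ} {τ} {n} t j a≡ p≤T A s≡ k = go j moves≡
        where
        γ : Sym′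
        γ = at C (pos C)
        moves≡ : P.moves (st C) γ ≡ runMoves N.accept 0 j ρ γ
        moves≡ = trans (cong (λ s → P.moves s γ) (trans s≡ (cong (λ s → running s 0 j ρ) a≡)))
          (running-moves N.accept γ z≤n (m+n≤o⇒n≤o ρ (bound A)) (m+n≤o⇒m≤o ρ (bound A)))
        go : ∀ j → P.moves (st C) γ ≡ runMoves N.accept 0 j ρ γ → Counts (cost j t + τ) C (1 choose suc j * n)
        go zero mv≡ =
          subst (Counts _ C) (trans (sym (*-identityˡ n)) (cong (_* n) (sym (nCn≡1 1))))
            (P.Counts-det (control≢accept {C} s≡) mv≡
              (P.Counts-≤ (m≤n+m τ _)
                (k (goto C (resume ρ) stay) (st-goto C (resume ρ) stay)
                   (≤-trans (≤-reflexive (trans (pos-goto C (resume ρ) stay) (head A))) p≤T)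
                   (LeftMarked-≗ C (goto C (resume ρ) stay) (at-goto C (resume ρ) stay) (edge A))
                   (λ {m} m<ρ i → cong (λ γ → track γ m) (at-goto C (resume ρ) stay i)))))
        go (suc j) mv≡ =
          P.Counts-suc (control≢accept {C} s≡) mv≡
            ([] , sym (cong (_* n) (k>n⇒nCk≡0 {1} {suc (suc j)} (s≤s (s≤s z≤n)))))

      run-count : ∀ t → RunCounts t
      run-count t {c} {C} {j} {τ = τ} {n} fin p≤T A s≡ k with N.st c Fin.≟ N.accept
      ... | yes a≡ =
        subst (λ x → Counts (cost j t + τ) C (x choose suc j * n)) (sym (N.accPaths-accept t c a≡))
          (accept-count t _ a≡ (m+n≤o⇒m≤o _ p≤T) A s≡ k)
      -- A configuration halted without accepting gives no options, in accordance with
      -- `0 choose suc j`.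
      run-count zero {c} {C} {j} h p≤T A s≡ k | no s≢ with m≡ , e ← N.halted c h s≢ =
        running-count s≢ A s≡ z≤n m≡
          ([] , sym (cong (_* _) (trans (cong (_choose suc j) e) (k>n⇒nCk≡0 {0} {suc j} (s≤s z≤n)))))
      run-count (suc t) {c} {C} {j} {n = n} fin p≤T A s≡ k | no s≢ =
        subst (λ x → Counts _ C (x choose suc j * n))
          (sym (trans (N.accPaths-suc t c s≢) (cong (sum ∘ map (accPaths N t)) (N.step≡ c))))
          (running-count {u = 0} s≢ A s≡ z≤n refl
            (options-count (run-count t) s≢ p≤T _ {0} refl
              (subst (All (Finishes N t)) (N.step≡ c) (N.Finishes-children t c fin)) A k))

      -- The first step on an input.

      Blank : Sym′ → Sym N → Set
      Blank γ y = (∀ m → track γ m ≡ (y , nothing)) × isLeft γ ≡ false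

      initial-symbol : ∀ x i → Blank (at (initial machine x) i) (N.at (initial N x) i)
      initial-symbol []       zero    = (λ _ → refl) , refl
      initial-symbol []       (suc i) = (λ _ → refl) , refl
      initial-symbol (b ∷ bs) i       = go (b ∷ bs) i
        where
        go : ∀ bs i → Blank (P.look (map (encBit machine) bs) i) (N.look (map (encBit N) bs) i)
        go []           i       = (λ _ → refl) , refl
        go (false ∷ bs) zero    = (λ _ → refl) , refl
        go (true ∷ bs)  zero    = (λ _ → refl) , refl
        go (b ∷ bs)     (suc i) = go bs i

      start-count : All (_≤ B) plan → ∀ x → Finishes N T (initial N x) →
        Counts (suc (cost B T)) (initial machine x) (weight plan (accPaths N T (initial N x)))
      start-count sizes x fin =
        P.Counts-suc start≢ (cong (λ s → P.moves s γ) (state machine x))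
          (subst (λ Cs → SumCounts (cost B T) Cs (weight plan a)) (map-∘ plan) (P.SumCounts-map each sizes))
        where
        C₀ : Config machine
        C₀ = initial machine x
        c₀ : Config N
        c₀ = initial N x
        γ : Sym′
        γ = at C₀ (pos C₀)
        a : ℕ
        a = accPaths N T c₀
        state : ∀ M x → Config.st (initial M x) ≡ zero
        state M []      = refl
        state M (_ ∷ _) = refl
        start : ∀ M x → Semantics.pos M (initial M x) ≡ 0
        start M []      = refl
        start M (_ ∷ _) = refl
        start≢ : st C₀ ≢ P.accept
        start≢ eq with () ← trans (sym (state machine x)) eq
        choice : ℕ → State′ × Sym′ × Move
        choice i = running zero 0 i 0 , cell true (track γ) , stay
        here : ∀ i → at (apply machine C₀ (choice i)) 0 ≡ cell true (track γ)
        here i = subst (λ p → at (apply machine C₀ (choice i)) p ≡ cell true (track γ)) (start machine x)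
                       (P.at-apply-here C₀ {running zero 0 i 0} stay)
        there : ∀ i p → at (apply machine C₀ (choice i)) (suc p) ≡ at C₀ (suc p)
        there i p = P.at-apply-there C₀ {running zero 0 i 0} {cell true (track γ)} stay λ eq → 1+n≢0 (trans eq (start machine x))
        tracks : ∀ i {m} → m ≤ B → ∀ p → track (at (apply machine C₀ (choice i)) p) m ≡ (N.at c₀ p , nothing)
        tracks i {m} m≤B zero    =
          trans (cong (λ γ → track γ m) (here i))
            (trans (track-cell true (track γ) m≤B)
              (trans (cong (λ p → track (at C₀ p) m) (start machine x)) (proj₁ (initial-symbol x 0) m)))
        tracks i {m} m≤B (suc p) =
          trans (cong (λ γ → track γ m) (there i p)) (proj₁ (initial-symbol x (suc p)) m)
        active : ∀ {i} → i ≤ B → Active (apply machine C₀ (choice i)) c₀ i 0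
        active {i} i≤B = record
          { bound    = i≤B
          ; head     = trans (P.pos-apply C₀ {running zero 0 i 0} {cell true (track γ)} stay)
                             (trans (start machine x) (sym (start N x)))
          ; contents = λ _ m≤ p → cong proj₁ (tracks i (≤-trans m≤ i≤B) p)
          ; unmarked = λ _ m< p → cong proj₂ (tracks i (≤-trans (<⇒≤ m<) i≤B) p)
          ; edge     = trans (cong isLeft (here i)) (flag-pack true _) ,
                       λ p → trans (cong isLeft (there i p)) (proj₂ (initial-symbol x (suc p)))
          }
        each : ∀ {i} → i ≤ B → Counts (cost B T) (apply machine C₀ (choice i)) (a choose suc i)
        each {i} i≤B =
          -- All guesses are padded to the common time `cost B T`.
          P.Counts-≤ (≤-trans (≤-reflexive (+-identityʳ (cost i T)))
                       (+-mono-≤ (*-monoˡ-≤ (suc T) (s≤s i≤B)) (*-monoˡ-≤ seekTime i≤B)))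
            (subst (Counts (cost i T + 0) (apply machine C₀ (choice i))) (*-identityʳ (a choose suc i))
              (run-count T {c₀} {τ = 0} {1} fin (≤-reflexive (cong (_+ T) (start N x))) (active i≤B)
                (trans (P.st-apply C₀ {running zero 0 i 0} {cell true (track γ)} stay) (cong (λ s → running s 0 i 0) (sym (state N x))))
                -- The bottom of the stack: `resume 0` is the accepting state, a continuation of
                -- time 0 worth 1.
                (λ C′ s≡ _ _ _ → P.Counts-accept 0 C′ s≡)))

-- Numbering the control states and the tape symbols.

Finite : Set → Set
Finite A = ∃ λ n → A ↪ Fin n

Fin-finite : ∀ n → Finite (Fin n)
Fin-finite n = n , ↔⇒↪ (↔-id (Fin n))

_×-finite_ : ∀ {A B} → Finite A → Finite B → Finite (A × B)
(m , A↪m) ×-finite (n , B↪n) = m * n , ↔⇒↪ (↔-sym *↔×) ↪-∘ (A↪m ×-↪ B↪n)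

_⊎-finite_ : ∀ {A B} → Finite A → Finite B → Finite (A ⊎ B)
(m , A↪m) ⊎-finite (n , B↪n) = m + n , ↔⇒↪ (↔-sym +↔⊎) ↪-∘ (A↪m ⊎-↪ B↪n)

Bool-finite : Finite Bool
Bool-finite = 2 , ↔⇒↪ (↔-sym 2↔Bool)

Maybe-finite : ∀ {A} → Finite A → Finite (Maybe A)
Maybe-finite {A} fin with n , code ← Fin-finite 1 ⊎-finite fin = n , code ↪-∘ mk↪ {to = to} {from} λ { refl → from-to _ }
  where
  to : Maybe A → Fin 1 ⊎ A
  to nothing  = inj₁ zero
  to (just x) = inj₂ x
  from : Fin 1 ⊎ A → Maybe A
  from (inj₁ _) = nothing
  from (inj₂ x) = just x
  from-to : ∀ x → from (to x) ≡ x
  from-to nothing  = refl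
  from-to (just x) = refl

Control-finite : ∀ s b → Finite (Control s b)
Control-finite s b
  with n , code ← (Fin-finite s ×-finite (Fin-finite b ×-finite (Fin-finite b ×-finite Fin-finite b))) ⊎-finite
                  (Fin-finite b ⊎-finite Fin-finite b)
  = n , code ↪-∘ mk↪ {to = to} {from} λ { refl → from-to _ }
  where
  Sum : Set
  Sum = (Fin s × Fin b × Fin b × Fin b) ⊎ (Fin b ⊎ Fin b)
  to : Control s b → Sum
  to (run s u j ρ) = inj₁ (s , u , j , ρ)
  to (rewind m)    = inj₂ (inj₁ m)
  to (scan m)      = inj₂ (inj₂ m)
  from : Sum → Control s b
  from (inj₁ (s , u , j , ρ)) = run s u j ρ
  from (inj₂ (inj₁ m))        = rewind m
  from (inj₂ (inj₂ m))        = scan m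
  from-to : ∀ x → from (to x) ≡ x
  from-to (run s u j ρ) = refl
  from-to (rewind m)    = refl
  from-to (scan m)      = refl

Track-finite : ∀ s y b → Finite (Track s y b)
Track-finite s y b = Fin-finite y ×-finite Maybe-finite (Fin-finite s ×-finite (Fin-finite b ×-finite Fin-finite b))

cellCode : ∀ {A b} → Finite A → CellCode A b
cellCode {A} {b} (n , code) = record
  { size       = 2 * n ^ b
  ; pack       = λ l f → combine (Flag.to l) (funToFin (A.to ∘ f))
  ; flag       = λ x → Flag.from (proj₁ (remQuot (n ^ b) x))
  ; entry      = λ x i → A.from (finToFun (proj₂ (remQuot {2} (n ^ b) x)) i)
  ; flag-pack  = λ l f → trans (cong (Flag.from ∘ proj₁) (remQuot-combine (Flag.to l) (funToFin (A.to ∘ f))))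
                               (Flag.strictlyInverseʳ l)
  ; entry-pack = λ l f i →
      trans (cong (λ x → A.from (finToFun (proj₂ x) i)) (remQuot-combine (Flag.to l) (funToFin (A.to ∘ f))))
        (trans (cong A.from (finToFun-funToFin (A.to ∘ f) i)) (A.strictlyInverseʳ (f i)))
  }
  where
  module A    = RightInverse code
  module Flag = RightInverse (proj₂ Bool-finite)

-- Uniform bounds and the polynomial running time.

Fin-bounded : ∀ n (f : Fin n → ℕ) → ∃ λ b → ∀ i → f i ≤ b
Fin-bounded zero    f = 0 , λ ()
Fin-bounded (suc n) f with b , f≤b ← Fin-bounded n (f ∘ suc) =
  f zero ⊔ b , λ { zero → m≤m⊔n (f zero) b ; (suc i) → ≤-trans (f≤b i) (m≤n⊔m (f zero) b) }

-- The index of the next open move is stored in states and marks, so it needs one bound for all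
-- states and symbols.
branching-bounded : ∀ N → ∃ λ b → ∀ s h → length (Semantics.moves N s h) ≤ b
branching-bounded N = proj₁ outer , λ s h → ≤-trans (proj₂ (inner s) h) (proj₂ outer s)
  where
  inner : ∀ s → ∃ λ b → ∀ h → length (Semantics.moves N s h) ≤ b
  inner s = Fin-bounded _ (λ h → length (Semantics.moves N s h))
  outer : ∃ λ b → ∀ s → proj₁ (inner s) ≤ b
  outer = Fin-bounded _ (proj₁ ∘ inner)

-- With `l` for `length x ^ d` and T = c l + c, the left side is 1 + (1 + 3b)(T + 1) = (2 + 3b) + (1
-- + 3b)T. An added (2 + 3b)l makes both coefficients equal, so the degree `d` is kept.
start-time : ∀ b c l →
  suc (suc b * suc (c * l + c) + b * (suc (c * l + c) + suc (c * l + c))) ≤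
  (2 + 3 * b + (1 + 3 * b) * c) * l + (2 + 3 * b + (1 + 3 * b) * c)
start-time b c l = m+n≤o⇒m≤o _ (≤-reflexive (eq b c l))
  where
  eq : ∀ b c l →
    suc (suc b * suc (c * l + c) + b * (suc (c * l + c) + suc (c * l + c))) + (2 + 3 * b) * l ≡
    (2 + 3 * b + (1 + 3 * b) * c) * l + (2 + 3 * b + (1 + 3 * b) * c)
  eq = solve 3 (λ b c l →
      let s = con 1 :+ (c :* l :+ c)
          e = con 2 :+ con 3 :* b :+ (con 1 :+ con 3 :* b) :* c
      in con 1 :+ ((con 1 :+ b) :* s :+ b :* (s :+ s)) :+ (con 2 :+ con 3 :* b) :* l := e :* l :+ e) refl
    where open +-*-Solver

module _ (N : NPTM) (plan : List ℕ) where
  open NPTM N renaming (machine to M)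

  weighted-coded : ∀ {B} → (∀ s h → length (Semantics.moves M s h) ≤ B) → All (_≤ B) plan →
    Finite (Control (3 + NTM.q M) (suc B)) →
    CellCode (Track (3 + NTM.q M) (3 + NTM.g M) (suc B)) (suc B) →
    ∃ λ N′ → ∀ x → #acc N′ x ≡ weight plan (#acc N x)
  weighted-coded {B} branching sizes (_ , control) cells =
    record { machine = machine ; c = c′ ; d = d ; polyTime = λ x → proj₁ (counts x) } , λ x → proj₂ (counts x)
    where
    open Subsets M plan B control cells using (machine; module P; module Run)
    c′ : ℕ
    c′ = 2 + 3 * B + (1 + 3 * B) * c
    counts : ∀ x → P.Counts (c′ * length x ^ d + c′) (initial machine x) (weight plan (#acc N x))
    counts x = P.Counts-≤ (start-time B c (length x ^ d))
      (Run.start-count (c * length x ^ d + c) branching sizes x (polyTime x))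

  weighted : ∀ {k} → All (_< k) plan → ∃ λ N′ → ∀ x → #acc N′ x ≡ weight plan (#acc N x)
  weighted {k} sizes with b , branching ← branching-bounded M =
    -- `B` has to bound both the subset sizes and the move indices.
    weighted-coded {k + b} (λ s h → ≤-trans (branching s h) (m≤n+m b k))
      (All.map (λ i<k → ≤-trans (<⇒≤ i<k) (m≤m+n k b)) sizes)
      (Control-finite (3 + NTM.q M) (suc (k + b)))
      (cellCode (Track-finite (3 + NTM.q M) (3 + NTM.g M) (suc (k + b))))

theorem4p3 : (T : ℕ → Set) → PosSubset T → Infinite T →
    (k : ℕ) → 1 ≤ k → (L : Language) → UP≤ k L → RC T L
theorem4p3 T _ inf k _ L (N , correct) = weighting (plan-into inf k)
  where
  accepting : ∀ {plan} → (∀ a → 1 ≤ a → a ≤ k → T (weight plan a)) →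
    (∃ λ N′ → ∀ x → #acc N′ x ≡ weight plan (#acc N x)) → RC T L
  accepting {plan} into (N′ , count) = N′ , λ x →
    (λ x∉L → trans (count x) (trans (cong (weight plan) (proj₁ (correct x) x∉L)) (weight-0 plan))) ,
    (λ x∈L → let 1≤a , a≤k = proj₂ (correct x) x∈L in subst T (sym (count x)) (into _ 1≤a a≤k))
  weighting : (∃ λ plan → All (_< k) plan × (∀ a → 1 ≤ a → a ≤ k → T (weight plan a))) → RC T L
  weighting (plan , sizes , into) = accepting {plan} into (weighted N plan sizes)
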